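{- Let $n\ge 1$ and let $L,U\subseteq[n]=\{1,\ldots,n\}$ with $L\cap U=\emptyset$. Then the number of parking functions of $1,\ldots,n$ such that for every $i\in L$ the $i$-th car parks in its preferred spot, for every $i\in U$ the $i$-th car does not park in its preferred spot, and there are no restrictions on the remaining cars, is \[ \bigg(\prod_{i\in L}(n+2-i)\bigg)\bigg(\prod_{i\in U}(i-1)\bigg)(n+1)^{n-|L|-|U|-1}. \]
   Context: There are $n$ spots labeled $1,\ldots,n$ in order along a one-way street, and $n$ cars entering one after another, car $i$ having preference $a_i\in\{1,\ldots,n\}$. Each car drives to its preferred spot and parks there if it is available; otherwise it moves forward and parks in the first available later spot, if any (if none, it fails to park). A parking function of $1,\ldots,n$ is a sequence of preferences $(a_1,\ldots,a_n)$ such that all $n$ cars are able to park. -}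

module Defs where

open import Data.Fin.Base using (Fin; zero; suc; toℕ)
open import Data.Fin.Properties using (all?) renaming (_≟_ to _≟ᶠ_)
open import Data.Fin.Subset using (Subset; inside; outside; ⊥; _∈_)
open import Data.Fin.Subset.Properties using (_∈?_)
open import Data.Integer.Base using (ℤ; +_; -[1+_])
open import Data.List.Base as List using (List; allFin; filter; length; map)
open import Data.List.Membership.Propositional using () renaming (_∈_ to _∈ˡ_)
open import Data.List.Membership.Propositional.Properties
  using (∈-allFin; ∈-cartesianProductWith⁺)
open import Data.List.Relation.Unary.All using ([])
open import Data.List.Relation.Unary.AllPairs using ([]; _∷_)
open import Data.List.Relation.Unary.Any using (here)
open import Data.List.Relation.Unary.Unique.Propositional using (Unique)
open import Data.List.Relation.Unary.Unique.Propositional.Properties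
  using (allFin⁺; cartesianProductWith⁺)
open import Data.Maybe.Base as Maybe using (Maybe; just; nothing)
open import Data.Maybe using (Is-just)
open import Data.Maybe.Properties using (≡-dec)
open import Data.Maybe.Relation.Unary.Any using (dec)
open import Data.Nat.Base as ℕ using (ℕ; zero; suc; NonZero)
open import Data.Nat.ListAction using (product)
open import Data.Nat.Properties using (m^n≢0)
open import Data.Product.Base using (_×_)
open import Data.Rational.Base using (ℚ; _/_)
open import Data.Unit.Base using (tt)
open import Data.Vec.Base using (Vec; []; _∷_; lookup; _[_]≔_)
open import Data.Vec.Properties using (∷-injective)
open import Level using (0ℓ)
open import Relation.Binary.PropositionalEquality using (_≡_; refl)
open import Relation.Nullary.Decidable using (yes; ¬?; _×-dec_; _→-dec_)
open import Relation.Nullary.Negation using (¬_)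
open import Relation.Unary using (Pred; Decidable)

private
  variable
    m n : ℕ

-- Spots and cars are elements of Fin n; the spot or car written i ∈ {1,…,n}
-- on paper is the element whose label is i.
label : Fin n → ℕ
label i = suc (toℕ i)

-- A set of occupied spots is a Subset: inside = occupied, outside = free.
firstFree : Subset n → Maybe (Fin n)
firstFree []              = nothing
firstFree (outside ∷ occ) = just zero
firstFree (inside  ∷ occ) = Maybe.map suc (firstFree occ)

-- The first free spot at or after the preferred one.
park : Subset n → Fin n → Maybe (Fin n)
park occ       zero    = firstFree occ
park (_ ∷ occ) (suc p) = Maybe.map suc (park occ p)

-- A car that fails to park leaves the street unchanged.
occupy : Subset n → Maybe (Fin n) → Subset n
occupy occ nothing  = occ
occupy occ (just s) = occ [ s ]≔ inside

parkAll : Subset n → Vec (Fin n) m → Vec (Maybe (Fin n)) m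
parkAll occ []       = []
parkAll occ (p ∷ ps) = park occ p ∷ parkAll (occupy occ (park occ p)) ps

spotOf : Vec (Fin n) n → Fin n → Maybe (Fin n)
spotOf a i = lookup (parkAll ⊥ a) i

IsParkingFunction : Vec (Fin n) n → Set
IsParkingFunction a = ∀ i → Is-just (spotOf a i)

ParksInPreferred : Vec (Fin n) n → Fin n → Set
ParksInPreferred a i = spotOf a i ≡ just (lookup a i)

Restricted : Subset n → Subset n → Vec (Fin n) n → Set
Restricted L U a = IsParkingFunction a
                 × (∀ i → i ∈ L → ParksInPreferred a i)
                 × (∀ i → i ∈ U → ¬ ParksInPreferred a i)

isParkingFunction? : Decidable (IsParkingFunction {n})
isParkingFunction? a = all? λ i → dec (λ _ → yes tt) (spotOf a i)

parksInPreferred? : (a : Vec (Fin n) n) → Decidable (ParksInPreferred a)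
parksInPreferred? a i = ≡-dec _≟ᶠ_ (spotOf a i) (just (lookup a i))

restricted? : (L U : Subset n) → Decidable (Restricted L U)
restricted? L U a =
  isParkingFunction? a
    ×-dec all? (λ i → (i ∈? L) →-dec parksInPreferred? a i)
    ×-dec all? (λ i → (i ∈? U) →-dec ¬? (parksInPreferred? a i))

sequences : ∀ n m → List (Vec (Fin n) m)
sequences n zero    = List.[ [] ]
sequences n (suc m) = List.cartesianProductWith _∷_ (allFin n) (sequences n m)

-- Each sequence is listed exactly once, so filtering `sequences` counts.
∈-sequences : (a : Vec (Fin n) m) → a ∈ˡ sequences n m
∈-sequences []      = here refl
∈-sequences (p ∷ a) = ∈-cartesianProductWith⁺ _∷_ (∈-allFin p) (∈-sequences a)

sequences-unique : ∀ n m → Unique (sequences n m)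
sequences-unique n zero    = [] ∷ []
sequences-unique n (suc m) =
  cartesianProductWith⁺ _∷_ ∷-injective (allFin⁺ n) (sequences-unique n m)

count : {P : Pred (Vec (Fin n) m) 0ℓ} → Decidable P → ℕ
count {n} {m} P? = length (filter P? (sequences n m))

∏ : Subset n → (Fin n → ℕ) → ℕ
∏ {n} S f = product (map f (filter (_∈? S) (allFin n)))

syntax ∏ S (λ i → e) = ∏[ i ∈ S ] e

fromℕ : ℕ → ℚ
fromℕ k = + k / 1

infixr 8 _^ℤ_

_^ℤ_ : (b : ℕ) → .{{NonZero b}} → ℤ → ℚ
b ^ℤ (+ k)    = fromℕ (b ℕ.^ k)
b ^ℤ -[1+ k ] = (+ 1 / (b ℕ.^ suc k)) {{m^n≢0 b (suc k)}}

{-# OPTIONS --safe #-}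
module Submission where

-- Pollak's argument: bend the street into a circle by joining its ends with one
-- extra spot. On the circle every car parks, and the (i+1)-st car, meeting i
-- occupied spots among n + 1, has n + 1 - i lucky and i unlucky preferences; so
-- the number of restricted circular sequences is a product over the cars.
-- Exactly one spot stays free, by rotation each spot equally often, and the
-- parking functions are the sequences for which it is the extra spot.

open import Data.Bool.Base using (if_then_else_; true; false)
import Data.Bool.Properties as Bool
open import Data.Fin.Base using (Fin; zero; suc; toℕ; inject₁) renaming (fromℕ to fromℕᶠ)
open import Data.Fin.Properties using (all?) renaming (_≟_ to _≟ᶠ_)
open import Data.Fin.Subset
  using (Subset; Side; inside; outside; ⊥; Empty; _∩_; _∪_; ∁; ∣_∣; _∈_)
open import Data.Fin.Subset.Properties
  using (_∈?_; drop-∷-Empty; ∣∁p∣≡n∸∣p∣; ∣⊥∣≡0)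
open import Data.Integer.Base using (+_; _-_)
import Data.Integer.Base as ℤ
import Data.Integer.Properties as ℤ
import Data.Integer.Tactic.RingSolver as ℤSolver
open import Data.List.Base as List
  using (List; []; _∷_; _++_; allFin; cartesianProductWith; filter; length; map; tabulate)
open import Data.List.Properties
  using (filter-++; filter-none; filter-≐; length-++; map-cong; map-tabulate; map-∘)
import Data.List.Relation.Unary.All as ListAll
open import Data.Maybe.Base as Maybe using (Maybe; just; nothing; _<∣>_)
open import Data.Maybe using (Is-just)
import Data.Maybe.Properties as Maybe
open import Data.Maybe.Relation.Unary.All as MaybeAll using (All; just; nothing)
import Data.Maybe.Relation.Unary.All.Properties as MaybeAll
open import Data.Maybe.Relation.Unary.Any using (dec; just)
open import Data.Nat.Base as ℕ using (ℕ; zero; suc; _+_; _∸_; _≥_; _≤_; _<_; _^_; s≤s; NonZero)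
open import Data.Nat.ListAction using (product)
import Data.Nat.Properties as ℕ
open import Data.Nat.Tactic.RingSolver using (solve-∀)
open import Data.Product.Base using (_×_; _,_; proj₁; proj₂)
open import Data.Rational.Base using (_*_; _/_)
import Data.Rational.Properties as ℚ
import Data.Rational.Unnormalised.Base as ℚᵘ
import Data.Rational.Unnormalised.Properties as ℚᵘ
open import Data.Unit.Base using (tt)
open import Data.Vec.Base as Vec using (Vec; []; _∷_; _∷ʳ_; lookup; replicate; _[_]≔_; here; there)
import Data.Vec.Properties as Vec
open import Function.Base using (_∘_; id)
open import Level using (0ℓ)
open import Relation.Binary.PropositionalEquality
open import Relation.Nullary.Decidable
  using (Dec; does; yes; no; ¬?; _×-dec_; _→-dec_)
open import Relation.Nullary.Negation using (¬_; contradiction)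
open import Relation.Unary using (Pred; Decidable; _≐_)
open import Defs
open import Algebra.Properties.Semiring.Sum ℕ.+-*-semiring
  using (sum; sum-cong-≗; ∑-comm; sum-init-last; *-distribˡ-sum; *-distribʳ-sum)

open ≡-Reasoning

private
  variable
    m n k : ℕ
    A : Set

-- Rotation of vectors

rotate : Vec A (suc n) → Vec A (suc n)
rotate (x ∷ xs) = xs ∷ʳ x

-- The position to which `rotate` moves the entry at a given position.
pred↻ : Fin (suc n) → Fin (suc n)
pred↻ zero    = fromℕᶠ _
pred↻ (suc i) = inject₁ i

lookup-∷ʳ-fromℕ : (xs : Vec A n) (x : A) → lookup (xs ∷ʳ x) (fromℕᶠ n) ≡ x
lookup-∷ʳ-fromℕ []       x = refl
lookup-∷ʳ-fromℕ (_ ∷ xs) x = lookup-∷ʳ-fromℕ xs x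

lookup-∷ʳ-inject₁ : (xs : Vec A n) (x : A) (i : Fin n) →
                    lookup (xs ∷ʳ x) (inject₁ i) ≡ lookup xs i
lookup-∷ʳ-inject₁ (_ ∷ xs) x zero    = refl
lookup-∷ʳ-inject₁ (_ ∷ xs) x (suc i) = lookup-∷ʳ-inject₁ xs x i

lookup-rotate : (xs : Vec A (suc n)) (i : Fin (suc n)) →
                lookup (rotate xs) (pred↻ i) ≡ lookup xs i
lookup-rotate (x ∷ xs) zero    = lookup-∷ʳ-fromℕ xs x
lookup-rotate (x ∷ xs) (suc i) = lookup-∷ʳ-inject₁ xs x i

∷ʳ-update-fromℕ : (xs : Vec A n) (x y : A) → (xs ∷ʳ x) [ fromℕᶠ n ]≔ y ≡ xs ∷ʳ y
∷ʳ-update-fromℕ []       x y = refl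
∷ʳ-update-fromℕ (z ∷ xs) x y = cong (z ∷_) (∷ʳ-update-fromℕ xs x y)

∷ʳ-update-inject₁ : (xs : Vec A n) (x y : A) (i : Fin n) →
                    (xs ∷ʳ x) [ inject₁ i ]≔ y ≡ (xs [ i ]≔ y) ∷ʳ x
∷ʳ-update-inject₁ (z ∷ xs) x y zero    = refl
∷ʳ-update-inject₁ (z ∷ xs) x y (suc i) = cong (z ∷_) (∷ʳ-update-inject₁ xs x y i)

rotate-update : (xs : Vec A (suc n)) (i : Fin (suc n)) (y : A) →
                rotate xs [ pred↻ i ]≔ y ≡ rotate (xs [ i ]≔ y)
rotate-update (x ∷ xs) zero    y = ∷ʳ-update-fromℕ xs x y
rotate-update (x ∷ xs) (suc i) y = ∷ʳ-update-inject₁ xs x y i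

rotate-replicate : (x : A) → rotate (replicate (suc n) x) ≡ replicate (suc n) x
rotate-replicate {n = zero}  x = refl
rotate-replicate {n = suc n} x = cong (x ∷_) (rotate-replicate x)

-- Precomposing with `pred↻` only moves the last summand to the front.
sum-pred↻ : (f : Fin (suc n) → ℕ) → sum (f ∘ pred↻) ≡ sum f
sum-pred↻ f = trans (ℕ.+-comm (f (fromℕᶠ _)) _) (sym (sum-init-last f))

-- The circular street

-- If nothing is free from `p` on, the first free spot of the whole street is the one reached after
-- wrapping around.
park↻ : Subset n → Fin n → Maybe (Fin n)
park↻ S p = park S p <∣> firstFree S

-- What an appended last spot with state `b` offers to a car that reaches it.
freeLast : Side → Maybe (Fin (suc n))
freeLast inside  = nothing
freeLast outside = just (fromℕᶠ _)

freeLast-suc : (b : Side) → Maybe.map suc (freeLast {n} b) ≡ freeLast b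
freeLast-suc inside  = refl
freeLast-suc outside = refl

map-suc-∷ʳ : (m : Maybe (Fin n)) (b : Side) →
             Maybe.map suc (Maybe.map inject₁ m <∣> freeLast b) ≡
             Maybe.map inject₁ (Maybe.map suc m) <∣> freeLast b
map-suc-∷ʳ (just _) b = refl
map-suc-∷ʳ nothing  b = freeLast-suc b

firstFree-∷ʳ : (S : Subset n) (b : Side) →
               firstFree (S ∷ʳ b) ≡ Maybe.map inject₁ (firstFree S) <∣> freeLast b
firstFree-∷ʳ []            inside  = refl
firstFree-∷ʳ []            outside = refl
firstFree-∷ʳ (outside ∷ S) b       = refl
firstFree-∷ʳ (inside ∷ S)  b       =
  trans (cong (Maybe.map suc) (firstFree-∷ʳ S b)) (map-suc-∷ʳ (firstFree S) b)

park-∷ʳ-inject₁ : (S : Subset n) (b : Side) (p : Fin n) →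
                  park (S ∷ʳ b) (inject₁ p) ≡ Maybe.map inject₁ (park S p) <∣> freeLast b
park-∷ʳ-inject₁ (c ∷ S) b zero    = firstFree-∷ʳ (c ∷ S) b
park-∷ʳ-inject₁ (c ∷ S) b (suc p) =
  trans (cong (Maybe.map suc) (park-∷ʳ-inject₁ S b p)) (map-suc-∷ʳ (park S p) b)

park-∷ʳ-fromℕ : (S : Subset n) (b : Side) → park (S ∷ʳ b) (fromℕᶠ n) ≡ freeLast b
park-∷ʳ-fromℕ []      inside  = refl
park-∷ʳ-fromℕ []      outside = refl
park-∷ʳ-fromℕ (_ ∷ S) b       =
  trans (cong (Maybe.map suc) (park-∷ʳ-fromℕ S b)) (freeLast-suc b)

map-pred↻-suc : (m : Maybe (Fin n)) → Maybe.map pred↻ (Maybe.map suc m) ≡ Maybe.map inject₁ m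
map-pred↻-suc nothing  = refl
map-pred↻-suc (just _) = refl

-- Both ways of cutting the circle search the spots in the same cyclic order: from the preference
-- on, then around. The cases follow which stretch of the street contains the first free spot.
park↻-rotate : (S : Subset (suc n)) (p : Fin (suc n)) →
               park↻ (rotate S) (pred↻ p) ≡ Maybe.map pred↻ (park↻ S p)
park↻-rotate (b ∷ S) zero
  rewrite park-∷ʳ-fromℕ S b | firstFree-∷ʳ S b with b
... | outside = refl
... | inside with firstFree S
...   | nothing = refl
...   | just _  = refl
park↻-rotate (b ∷ S) (suc p)
  rewrite park-∷ʳ-inject₁ S b p | firstFree-∷ʳ S b with park S p | b
... | just _  | _       = refl
... | nothing | outside = refl
... | nothing | inside  with firstFree S
...   | nothing = refl
...   | just _  = refl

occupy-rotate : (S : Subset (suc n)) (s : Maybe (Fin (suc n))) →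
                occupy (rotate S) (Maybe.map pred↻ s) ≡ rotate (occupy S s)
occupy-rotate S nothing  = refl
occupy-rotate S (just s) = rotate-update S s inside

-- Each car occupies one more spot of the circle

FreeSpot : Subset n → Fin n → Set
FreeSpot S s = lookup S s ≡ outside

firstFree-free : (S : Subset n) → All (FreeSpot S) (firstFree S)
firstFree-free []            = nothing
firstFree-free (outside ∷ S) = just refl
firstFree-free (inside ∷ S)  = MaybeAll.map⁺ (firstFree-free S)

park-free : (S : Subset n) (p : Fin n) → All (FreeSpot S) (park S p)
park-free S       zero    = firstFree-free S
park-free (_ ∷ S) (suc p) = MaybeAll.map⁺ (park-free S p)

firstFree≡nothing⇒full : (S : Subset n) → firstFree S ≡ nothing → ∣ S ∣ ≡ n
firstFree≡nothing⇒full []            _ = refl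
firstFree≡nothing⇒full (inside ∷ S) eq with firstFree S in eq′
... | nothing = cong suc (firstFree≡nothing⇒full S eq′)

∣update∣ : (S : Subset n) (s : Fin n) → FreeSpot S s → ∣ S [ s ]≔ inside ∣ ≡ suc ∣ S ∣
∣update∣ (outside ∷ S) zero    refl = refl
∣update∣ (outside ∷ S) (suc s) free = ∣update∣ S s free
∣update∣ (inside ∷ S)  (suc s) free = cong suc (∣update∣ S s free)

-- The search with wrap-around fails only on a full circle, and the spot it finds was free before.
∣occupy-park↻∣ : (S : Subset n) (p : Fin n) → ∣ S ∣ < n →
                 ∣ occupy S (park↻ S p) ∣ ≡ suc ∣ S ∣
∣occupy-park↻∣ S p notFull with park S p | park-free S p
... | just s  | just free = ∣update∣ S s free
... | nothing | _ with firstFree S in eq | firstFree-free S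
...   | just s  | just free = ∣update∣ S s free
...   | nothing | _         =
  contradiction (firstFree≡nothing⇒full S eq) (ℕ.<⇒≢ notFull)

-- Counting restricted sequences on the circle

-- A car gets its preferred spot exactly when that spot is free on arrival, so both restrictions
-- depend only on the state `b` of that spot. `l` and `u` record membership of the car in `L` and
-- `U`.
Fits : Side → Side → Side → Set
Fits l u b = (l ≡ inside → b ≡ outside) × (u ≡ inside → ¬ b ≡ outside)

fits? : ∀ l u b → Dec (Fits l u b)
fits? l u b = ((l Bool.≟ inside) →-dec (b Bool.≟ outside))
         ×-dec ((u Bool.≟ inside) →-dec ¬? (b Bool.≟ outside))

indicator : {P : Set} → Dec P → ℕ
indicator P? = if does P? then 1 else 0

-- The number of preference sequences for cars restricted by L and U that enter
-- a circular street with occupied spots S and leave the spot e free at the end.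
completions : Subset m → Subset m → Subset n → Fin n → ℕ
completions []      []      S e = if lookup S e then 0 else 1
completions (l ∷ L) (u ∷ U) S e =
  sum λ p → indicator (fits? l u (lookup S p)) ℕ.* completions L U (occupy S (park↻ S p)) e

-- Rotate the first preference along with the street: reindexing the sum by `pred↻` matches the
-- summands, because parking commutes with rotation.
completions-rotate : (L U : Subset m) (S : Subset (suc n)) (e : Fin (suc n)) →
                     completions L U (rotate S) (pred↻ e) ≡ completions L U S e
completions-rotate []      []      S e = cong (if_then 0 else 1) (lookup-rotate S e)
completions-rotate (l ∷ L) (u ∷ U) S e =
  trans (sym (sum-pred↻ (summand (rotate S) (pred↻ e)))) (sum-cong-≗ λ p →
    cong₂ (λ b c → indicator (fits? l u b) ℕ.* c) (lookup-rotate S p) (begin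
      completions L U (occupy (rotate S) (park↻ (rotate S) (pred↻ p))) (pred↻ e)
        ≡⟨ cong (λ s → completions L U (occupy (rotate S) s) (pred↻ e)) (park↻-rotate S p) ⟩
      completions L U (occupy (rotate S) (Maybe.map pred↻ (park↻ S p))) (pred↻ e)
        ≡⟨ cong (λ T → completions L U T (pred↻ e)) (occupy-rotate S (park↻ S p)) ⟩
      completions L U (rotate (occupy S (park↻ S p))) (pred↻ e)
        ≡⟨ completions-rotate L U (occupy S (park↻ S p)) e ⟩
      completions L U (occupy S (park↻ S p)) e ∎))
  where
  summand : Subset (suc _) → Fin (suc _) → Fin (suc _) → ℕ
  summand S e p =
    indicator (fits? l u (lookup S p)) ℕ.* completions L U (occupy S (park↻ S p)) e

inject₁≗suc⇒constant : (f : Fin (suc n) → ℕ) → f ∘ inject₁ ≗ f ∘ suc →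
                       ∀ i → f i ≡ f zero
inject₁≗suc⇒constant             f eq zero    = refl
inject₁≗suc⇒constant {n = suc n} f eq (suc i) =
  trans (inject₁≗suc⇒constant (f ∘ suc) (eq ∘ suc) i) (sym (eq zero))

-- The empty circle is fixed by rotation, so neighbouring spots, and hence all spots, remain free
-- equally often.
completions-⊥ : (L U : Subset m) (e : Fin (suc n)) →
                completions L U ⊥ e ≡ completions L U ⊥ zero
completions-⊥ L U = inject₁≗suc⇒constant (completions L U ⊥) λ i →
  trans (cong (λ S → completions L U S (inject₁ i)) (sym (rotate-replicate outside)))
        (completions-rotate L U ⊥ (suc i))

sum-const : ∀ n (c : ℕ) → sum {n} (λ _ → c) ≡ n ℕ.* c
sum-const zero    c = refl
sum-const (suc n) c = cong (_+_ c) (sum-const n c)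

sum-lookup : (S : Subset n) (g : Side → ℕ) →
             sum (g ∘ lookup S) ≡ ∣ S ∣ ℕ.* g inside + (n ∸ ∣ S ∣) ℕ.* g outside
sum-lookup S g = trans (go S) (cong (λ k → ∣ S ∣ ℕ.* g inside + k ℕ.* g outside) (∣∁p∣≡n∸∣p∣ S))
  where
  go : (S : Subset k) → sum (g ∘ lookup S) ≡ ∣ S ∣ ℕ.* g inside + ∣ ∁ S ∣ ℕ.* g outside
  go []            = refl
  go (inside ∷ S)  = trans (cong (_+_ (g inside)) (go S)) (sym (ℕ.+-assoc (g inside) _ _))
  go (outside ∷ S) = trans (cong (_+_ (g outside)) (go S)) (swap (g outside) (∣ S ∣ ℕ.* g inside) _)
    where
    swap : ∀ a b c → a + (b + c) ≡ b + (a + c)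
    swap = solve-∀

-- The number of preferences among N circular spots, k of them occupied, for
-- the next car.
choices : Side → Side → ℕ → ℕ → ℕ
choices l u N k = k ℕ.* indicator (fits? l u inside) + (N ∸ k) ℕ.* indicator (fits? l u outside)

-- Here `k` is the number of spots occupied when the first of the listed cars enters; it grows by
-- one per car, whatever the preferences are.
total : ℕ → Subset m → Subset m → ℕ → ℕ
total N []      []      k = 1
total N (l ∷ L) (u ∷ U) k = choices l u N k ℕ.* total N L U (suc k)

-- The hypothesis says that the `m` cars leave exactly one of the `n + 1` spots free, so the sum
-- over `e` counts each admissible sequence once.
sum-completions : (L U : Subset m) (S : Subset (suc n)) → ∣ S ∣ + m ≡ n →
                  sum (completions L U S) ≡ total (suc n) L U ∣ S ∣
sum-completions {n = n} [] [] S eq = begin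
  sum (λ e → if lookup S e then 0 else 1)  ≡⟨ sum-lookup S (if_then 0 else 1) ⟩
  ∣ S ∣ ℕ.* 0 + (suc n ∸ ∣ S ∣) ℕ.* 1      ≡⟨ cong₂ _+_ (ℕ.*-zeroʳ ∣ S ∣) (ℕ.*-identityʳ _) ⟩
  suc n ∸ ∣ S ∣                            ≡⟨ cong (λ k → suc k ∸ ∣ S ∣) (trans (sym eq) (ℕ.+-identityʳ _)) ⟩
  suc ∣ S ∣ ∸ ∣ S ∣                        ≡⟨ ℕ.m+n∸n≡m 1 ∣ S ∣ ⟩
  1                                        ∎
sum-completions {m = suc m} {n = n} (l ∷ L) (u ∷ U) S eq = begin
  sum (λ e → sum λ p → w p ℕ.* completions L U (next p) e)
    -- With the free spot summed innermost, induction applies after each first preference. The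
    -- result `t` depends only on the number of occupied spots, so it factors out.
    ≡⟨ ∑-comm (λ e p → w p ℕ.* completions L U (next p) e) ⟩
  sum (λ p → sum λ e → w p ℕ.* completions L U (next p) e)
    ≡⟨ sum-cong-≗ (λ p → trans (sym (*-distribˡ-sum (w p) (completions L U (next p))))
                               (cong (w p ℕ.*_) (rest p))) ⟩
  sum (λ p → w p ℕ.* t)
    ≡⟨ *-distribʳ-sum t w ⟨
  sum w ℕ.* t
    ≡⟨ cong (ℕ._* t) (sum-lookup S (λ b → indicator (fits? l u b))) ⟩
  choices l u (suc n) ∣ S ∣ ℕ.* t ∎
  where
  w : Fin (suc n) → ℕ
  w p = indicator (fits? l u (lookup S p))
  next : Fin (suc n) → Subset (suc n)
  next p = occupy S (park↻ S p)
  t : ℕ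
  t = total (suc n) L U (suc ∣ S ∣)
  eq′ : suc ∣ S ∣ + m ≡ n
  eq′ = trans (sym (ℕ.+-suc ∣ S ∣ m)) eq
  notFull : ∣ S ∣ < suc n
  notFull = s≤s (ℕ.≤-trans (ℕ.m≤m+n ∣ S ∣ (suc m)) (ℕ.≤-reflexive eq))
  rest : ∀ p → sum (completions L U (next p)) ≡ t
  rest p = trans (sum-completions L U (next p) (trans (cong (_+ m) grown) eq′))
                 (cong (total (suc n) L U) grown)
    where
    grown : ∣ next p ∣ ≡ suc ∣ S ∣
    grown = ∣occupy-park↻∣ S p notFull


-- The street as a circle cut at the extra spot zero

-- Cars never leave, so an occupied spot cannot be the free one at the end.
completions-occupied : (L U : Subset m) (S : Subset n) (e : Fin n) →
                       lookup S e ≡ inside → completions L U S e ≡ 0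
completions-occupied         []      []      S e occ = cong (if_then 0 else 1) occ
completions-occupied {n = n} (l ∷ L) (u ∷ U) S e occ = begin
  sum (λ p → w p ℕ.* completions L U (occupy S (park↻ S p)) e)
    ≡⟨ sum-cong-≗ (λ p → trans
         (cong (w p ℕ.*_) (completions-occupied L U _ e (stays (park↻ S p))))
         (ℕ.*-zeroʳ (w p))) ⟩
  sum {n} (λ _ → 0)
    ≡⟨ sum-const n 0 ⟩
  n ℕ.* 0
    ≡⟨ ℕ.*-zeroʳ n ⟩
  0 ∎
  where
  w : Fin n → ℕ
  w p = indicator (fits? l u (lookup S p))
  stays : ∀ s → lookup (occupy S s) e ≡ inside
  stays nothing  = occ
  stays (just s) with s ≟ᶠ e
  ... | yes refl = Vec.lookup∘update s S inside
  ... | no s≢e   = trans (Vec.lookup∘update′ (s≢e ∘ sym) S inside) occ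

-- `Restricted` for a partly occupied street and any number of remaining cars, the form in which
-- induction on the cars goes through.
RestrictedFrom : Subset n → Subset m → Subset m → Pred (Vec (Fin n) m) 0ℓ
RestrictedFrom S L U a = (∀ i → Is-just (lookup (parkAll S a) i))
                       × (∀ i → i ∈ L → lookup (parkAll S a) i ≡ just (lookup a i))
                       × (∀ i → i ∈ U → ¬ lookup (parkAll S a) i ≡ just (lookup a i))

restrictedFrom? : (S : Subset n) (L U : Subset m) → Decidable (RestrictedFrom S L U)
restrictedFrom? S L U a =
  all? (λ i → dec (λ _ → yes tt) (lookup (parkAll S a) i))
    ×-dec all? (λ i → (i ∈? L) →-dec preferred? i)
    ×-dec all? (λ i → (i ∈? U) →-dec ¬? (preferred? i))
  where
  preferred? : ∀ i → Dec (lookup (parkAll S a) i ≡ just (lookup a i))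
  preferred? i = Maybe.≡-dec _≟ᶠ_ (lookup (parkAll S a) i) (just (lookup a i))

-- Counting sequences by their first preference

count-≐ : {P Q : Pred (Vec (Fin n) m) 0ℓ} (P? : Decidable P) (Q? : Decidable Q) →
          P ≐ Q → count P? ≡ count Q?
count-≐ P? Q? P≐Q = cong length (filter-≐ P? Q? P≐Q (sequences _ _))

count-none : {P : Pred (Vec (Fin n) m) 0ℓ} (P? : Decidable P) →
             (∀ a → ¬ P a) → count P? ≡ 0
count-none P? ¬P = cong length (filter-none P? (ListAll.universal ¬P (sequences _ _)))

count-×ˡ : {P : Pred (Vec (Fin n) m) 0ℓ} {Q : Set} (Q? : Dec Q) (P? : Decidable P) →
           count (λ a → Q? ×-dec P? a) ≡ indicator Q? ℕ.* count P?
count-×ˡ (yes q) P? =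
  trans (count-≐ (λ a → yes q ×-dec P? a) P? (proj₂ , λ p → q , p)) (sym (ℕ.+-identityʳ _))
count-×ˡ (no ¬q) P? = count-none (λ a → no ¬q ×-dec P? a) (λ _ → ¬q ∘ proj₁)

length-filter-map : {A B : Set} {P : Pred B 0ℓ} (P? : Decidable P) (f : A → B) (xs : List A) →
                    length (filter P? (map f xs)) ≡ length (filter (P? ∘ f) xs)
length-filter-map P? f []       = refl
length-filter-map P? f (x ∷ xs) with does (P? (f x))
... | true  = cong suc (length-filter-map P? f xs)
... | false = length-filter-map P? f xs

count-∷ : {P : Pred (Vec (Fin n) (suc m)) 0ℓ} (P? : Decidable P) →
          count P? ≡ sum (λ p → count (λ a → P? (p ∷ a)))
count-∷ {n} {m} P? = go id
  where
  -- `allFin n` is `tabulate id`; induction along the table needs an arbitrary `g` in place of `id`.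
  go : (g : Fin k → Fin n) →
       length (filter P? (cartesianProductWith _∷_ (tabulate g) (sequences n m))) ≡
       sum (λ i → count (λ a → P? (g i ∷ a)))
  go {zero}  g = refl
  go {suc k} g = begin
    length (filter P? (map (g zero ∷_) xs ++ rest))
      ≡⟨ cong length (filter-++ P? (map (g zero ∷_) xs) rest) ⟩
    length (filter P? (map (g zero ∷_) xs) ++ filter P? rest)
      ≡⟨ length-++ (filter P? (map (g zero ∷_) xs)) ⟩
    length (filter P? (map (g zero ∷_) xs)) + length (filter P? rest)
      ≡⟨ cong₂ _+_ (length-filter-map P? (g zero ∷_) xs) (go (g ∘ suc)) ⟩
    count (λ a → P? (g zero ∷ a)) + sum (λ i → count (λ a → P? (g (suc i) ∷ a))) ∎
    where
    xs   = sequences n m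
    rest = cartesianProductWith _∷_ (tabulate (g ∘ suc)) xs

park≡pref⇒free : (S : Subset n) (p : Fin n) → park S p ≡ just p → lookup S p ≡ outside
park≡pref⇒free S p eq with park S p | park-free S p
park≡pref⇒free S p refl | just _ | just free = free

free⇒park≡pref : (S : Subset n) (p : Fin n) → lookup S p ≡ outside → park S p ≡ just p
free⇒park≡pref (outside ∷ S) zero    _    = refl
free⇒park≡pref (_ ∷ S)       (suc p) free = cong (Maybe.map suc) (free⇒park≡pref S p free)

-- Once the first car is known to park at `s`, its own restriction is a condition on the state of
-- spot `p`, and the others concern the street with `s` occupied.
restrictedFrom-∷ : ∀ (S : Subset n) l u (L U : Subset m) {p s} → park S p ≡ just s →
  (RestrictedFrom S (l ∷ L) (u ∷ U) ∘ (p ∷_)) ≐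
  (λ a → Fits l u (lookup S p) × RestrictedFrom (S [ s ]≔ inside) L U a)
restrictedFrom-∷ S l u L U {p} {s} parked = to , from
  where
  to : ∀ {a} → RestrictedFrom S (l ∷ L) (u ∷ U) (p ∷ a) →
       Fits l u (lookup S p) × RestrictedFrom (S [ s ]≔ inside) L U a
  to {a} (ok , lucky , unlucky) =
    ( (λ { refl → park≡pref⇒free S p (lucky zero here) })
    , (λ { refl free → unlucky zero here (free⇒park≡pref S p free) }) ) ,
    subst (λ t → RestrictedFrom (occupy S t) L U a) parked
      ( ok ∘ suc , (λ i → lucky (suc i) ∘ there) , (λ i → unlucky (suc i) ∘ there) )
  from : ∀ {a} → Fits l u (lookup S p) × RestrictedFrom (S [ s ]≔ inside) L U a →
         RestrictedFrom S (l ∷ L) (u ∷ U) (p ∷ a)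
  from {a} ((lucky₀ , unlucky₀) , restricted)
    with ok , lucky , unlucky ←
      subst (λ t → RestrictedFrom (occupy S t) L U a) (sym parked) restricted =
      (λ { zero → subst Is-just (sym parked) (just tt) ; (suc i) → ok i })
    , (λ { zero here → free⇒park≡pref S p (lucky₀ refl)
         ; (suc i) (there i∈L) → lucky i i∈L })
    , (λ { zero here → unlucky₀ refl ∘ park≡pref⇒free S p
         ; (suc i) (there i∈U) → unlucky i i∈U })

-- A car fails to park on the street iff on the circle it takes the extra spot.
count-restrictedFrom : (S : Subset n) (L U : Subset m) →
  count (restrictedFrom? S L U) ≡ completions L U (outside ∷ S) zero
count-restrictedFrom S [] [] = refl
count-restrictedFrom {n = n} S (l ∷ L) (u ∷ U) = begin
  count (restrictedFrom? S (l ∷ L) (u ∷ U))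
    ≡⟨ count-∷ (restrictedFrom? S (l ∷ L) (u ∷ U)) ⟩
  sum (λ p → count (λ a → restrictedFrom? S (l ∷ L) (u ∷ U) (p ∷ a)))
    ≡⟨ sum-cong-≗ step ⟩
  sum (summand ∘ suc)
    ≡⟨ cong (_+ sum (summand ∘ suc)) summand-zero ⟨
  sum summand ∎
  where
  summand : Fin (suc n) → ℕ
  summand p = indicator (fits? l u (lookup (outside ∷ S) p)) ℕ.*
              completions L U (occupy (outside ∷ S) (park↻ (outside ∷ S) p)) zero
  -- A car preferring the extra spot takes it, since it is free; then it cannot be the spot left
  -- free.
  summand-zero : summand zero ≡ 0
  summand-zero = trans
    (cong (indicator (fits? l u outside) ℕ.*_) (completions-occupied L U (inside ∷ S) zero refl))
    (ℕ.*-zeroʳ (indicator (fits? l u outside)))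
  -- As the extra spot is free, `firstFree (outside ∷ S)` is `just zero`: a car that runs off the
  -- street ends there.
  completionsAfter : Maybe (Fin n) → ℕ
  completionsAfter s = completions L U (occupy (outside ∷ S) (Maybe.map suc s <∣> just zero)) zero
  step : ∀ p → count (λ a → restrictedFrom? S (l ∷ L) (u ∷ U) (p ∷ a)) ≡ summand (suc p)
  step p = go (park S p) refl
    where
    P? : Decidable (λ a → RestrictedFrom S (l ∷ L) (u ∷ U) (p ∷ a))
    P? a = restrictedFrom? S (l ∷ L) (u ∷ U) (p ∷ a)
    w = indicator (fits? l u (lookup S p))
    go : ∀ s → park S p ≡ s → count P? ≡ summand (suc p)
    go nothing eq = begin
      count P?
        ≡⟨ count-none P? (λ { a (ok , _) → contradiction (subst Is-just eq (ok zero)) λ () }) ⟩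
      0
        ≡⟨ ℕ.*-zeroʳ w ⟨
      w ℕ.* 0
        ≡⟨ cong (w ℕ.*_) (completions-occupied L U (inside ∷ S) zero refl) ⟨
      w ℕ.* completionsAfter nothing
        ≡⟨ cong (λ t → w ℕ.* completionsAfter t) eq ⟨
      summand (suc p) ∎
    go (just s) eq = begin
      count P?
        ≡⟨ count-≐ P? (λ a → fits? l u (lookup S p) ×-dec restrictedFrom? (S [ s ]≔ inside) L U a)
             (restrictedFrom-∷ S l u L U eq) ⟩
      count (λ a → fits? l u (lookup S p) ×-dec restrictedFrom? (S [ s ]≔ inside) L U a)
        ≡⟨ count-×ˡ (fits? l u (lookup S p)) (restrictedFrom? (S [ s ]≔ inside) L U) ⟩
      w ℕ.* count (restrictedFrom? (S [ s ]≔ inside) L U)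
        ≡⟨ cong (w ℕ.*_) (count-restrictedFrom (S [ s ]≔ inside) L U) ⟩
      w ℕ.* completionsAfter (just s)
        ≡⟨ cong (λ t → w ℕ.* completionsAfter t) eq ⟨
      summand (suc p) ∎

-- By symmetry each of the `n + 1` spots is left free by as many circular sequences as the extra
-- spot is, so `n + 1` copies of the count exhaust the circular sequences.
count-restricted : (L U : Subset n) → suc n ℕ.* count (restricted? L U) ≡ total (suc n) L U 0
count-restricted {n} L U = begin
  suc n ℕ.* count (restricted? L U)
    -- Starting from the empty street, `RestrictedFrom` unfolds to `Restricted`.
    ≡⟨ cong (suc n ℕ.*_) (count-≐ (restricted? L U) (restrictedFrom? ⊥ L U) (id , id)) ⟩
  suc n ℕ.* count (restrictedFrom? ⊥ L U)
    ≡⟨ cong (suc n ℕ.*_) (count-restrictedFrom ⊥ L U) ⟩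
  suc n ℕ.* completions L U ⊥₁ zero
    ≡⟨ sum-const (suc n) (completions L U ⊥₁ zero) ⟨
  sum {suc n} (λ _ → completions L U ⊥₁ zero)
    ≡⟨ sum-cong-≗ (completions-⊥ L U) ⟨
  sum (completions L U ⊥₁)
    ≡⟨ sum-completions L U ⊥₁ (cong (_+ n) (∣⊥∣≡0 n)) ⟩
  total (suc n) L U ∣ ⊥ {n = n} ∣
    ≡⟨ cong (total (suc n) L U) (∣⊥∣≡0 n) ⟩
  total (suc n) L U 0 ∎
  where
  ⊥₁ : Subset (suc n)
  ⊥₁ = ⊥

-- The product of choices in closed form

filter-∈?-∷ : (b : Side) (S : Subset n) (xs : List (Fin n)) →
              filter (_∈? (b ∷ S)) (map suc xs) ≡ map suc (filter (_∈? S) xs)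
filter-∈?-∷ b S []       = refl
filter-∈?-∷ b S (x ∷ xs) with does (x ∈? S)
... | true  = cong (suc x ∷_) (filter-∈?-∷ b S xs)
... | false = filter-∈?-∷ b S xs

∏-tail : (b : Side) (S : Subset n) (f : Fin (suc n) → ℕ) →
         product (map f (filter (_∈? (b ∷ S)) (tabulate suc))) ≡ ∏ S (f ∘ suc)
∏-tail {n} b S f = cong product (begin
  map f (filter (_∈? (b ∷ S)) (tabulate suc))
    ≡⟨ cong (map f ∘ filter (_∈? (b ∷ S))) (map-tabulate id suc) ⟨
  map f (filter (_∈? (b ∷ S)) (map suc (allFin n)))
    ≡⟨ cong (map f) (filter-∈?-∷ b S (allFin n)) ⟩
  map f (map suc (filter (_∈? S) (allFin n)))
    ≡⟨ map-∘ _ ⟨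
  map (f ∘ suc) (filter (_∈? S) (allFin n)) ∎)

∏-outside : (S : Subset n) (f : Fin (suc n) → ℕ) → ∏ (outside ∷ S) f ≡ ∏ S (f ∘ suc)
∏-outside S f = ∏-tail outside S f

∏-inside : (S : Subset n) (f : Fin (suc n) → ℕ) →
           ∏ (inside ∷ S) f ≡ f zero ℕ.* ∏ S (f ∘ suc)
∏-inside S f = cong (f zero ℕ.*_) (∏-tail inside S f)

∏-cong : (S : Subset n) {f g : Fin n → ℕ} → f ≗ g → ∏ S f ≡ ∏ S g
∏-cong S eq = cong product (map-cong eq (filter (_∈? S) (allFin _)))

-- The car at index `i` meets `k + i` occupied spots: these are its unlucky preferences, the other
-- spots its lucky ones. A car outside `L` and `U` has all `N` preferences.
total-closed : ∀ N (L U : Subset m) k → Empty (L ∩ U) → k + m ≤ N →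
  total N L U k ≡
  ∏[ i ∈ L ] (N ∸ (k + toℕ i)) ℕ.* ∏[ i ∈ U ] (k + toℕ i) ℕ.* N ^ ∣ ∁ (L ∪ U) ∣
total-closed N [] [] k _ _ = refl
total-closed {suc m} N (l ∷ L) (u ∷ U) k disjoint k+m≤N = begin
  choices l u N k ℕ.* total N L U (suc k)
    ≡⟨ cong (choices l u N k ℕ.*_)
         (total-closed N L U (suc k) (drop-∷-Empty disjoint) (subst (_≤ N) (ℕ.+-suc k m) k+m≤N)) ⟩
  choices l u N k ℕ.* (∏[ i ∈ L ] (N ∸ (suc k + toℕ i)) ℕ.* ∏[ i ∈ U ] (suc k + toℕ i) ℕ.* N ^ ∣ ∁ (L ∪ U) ∣)
    ≡⟨ cong₂ (λ x y → choices l u N k ℕ.* (x ℕ.* y ℕ.* N ^ ∣ ∁ (L ∪ U) ∣))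
         -- Index `i` after the first car is index `suc i` overall: `suc k + i` becomes `k + suc i`.
         (∏-cong L (λ i → cong (N ∸_) (sym (ℕ.+-suc k (toℕ i)))))
         (∏-cong U (λ i → sym (ℕ.+-suc k (toℕ i)))) ⟩
  choices l u N k ℕ.* (∏ L (f ∘ suc) ℕ.* ∏ U (g ∘ suc) ℕ.* N ^ ∣ ∁ (L ∪ U) ∣)
    ≡⟨ go l u disjoint ⟩
  ∏ (l ∷ L) f ℕ.* ∏ (u ∷ U) g ℕ.* N ^ ∣ ∁ ((l ∷ L) ∪ (u ∷ U)) ∣ ∎
  where
  f g : Fin (suc m) → ℕ
  f i = N ∸ (k + toℕ i)
  g i = k + toℕ i
  k≤N : k ≤ N
  k≤N = ℕ.≤-trans (ℕ.m≤m+n k (suc m)) k+m≤N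
  go : ∀ l u → Empty ((l ∷ L) ∩ (u ∷ U)) →
       choices l u N k ℕ.* (∏ L (f ∘ suc) ℕ.* ∏ U (g ∘ suc) ℕ.* N ^ ∣ ∁ (L ∪ U) ∣) ≡
       ∏ (l ∷ L) f ℕ.* ∏ (u ∷ U) g ℕ.* N ^ ∣ ∁ ((l ∷ L) ∪ (u ∷ U)) ∣
  go inside inside disj = contradiction (zero , here) disj
  go inside outside _
    rewrite ∏-inside L f | ∏-outside U g | ℕ.+-identityʳ k =
    lemma k (N ∸ k) (∏ L (f ∘ suc)) (∏ U (g ∘ suc)) (N ^ ∣ ∁ (L ∪ U) ∣)
    where
    lemma : ∀ k c x y z → (k ℕ.* 0 + c ℕ.* 1) ℕ.* (x ℕ.* y ℕ.* z) ≡ c ℕ.* x ℕ.* y ℕ.* z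
    lemma = solve-∀
  go outside inside _
    rewrite ∏-outside L f | ∏-inside U g | ℕ.+-identityʳ k =
    lemma k (N ∸ k) (∏ L (f ∘ suc)) (∏ U (g ∘ suc)) (N ^ ∣ ∁ (L ∪ U) ∣)
    where
    lemma : ∀ k c x y z → (k ℕ.* 1 + c ℕ.* 0) ℕ.* (x ℕ.* y ℕ.* z) ≡ x ℕ.* (k ℕ.* y) ℕ.* z
    lemma = solve-∀
  -- Occupied and free spots together give `k + (N ∸ k)`, which is `N` because `k ≤ N`.
  go outside outside _
    rewrite ∏-outside L f | ∏-outside U g = trans
    (lemma k (N ∸ k) (∏ L (f ∘ suc)) (∏ U (g ∘ suc)) (N ^ ∣ ∁ (L ∪ U) ∣))
    (cong (λ c → ∏ L (f ∘ suc) ℕ.* ∏ U (g ∘ suc) ℕ.* (c ℕ.* N ^ ∣ ∁ (L ∪ U) ∣)) (ℕ.m+[n∸m]≡n k≤N))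
    where
    lemma : ∀ k c x y z → (k ℕ.* 1 + c ℕ.* 1) ℕ.* (x ℕ.* y ℕ.* z) ≡ x ℕ.* y ℕ.* ((k + c) ℕ.* z)
    lemma = solve-∀

∣∁∪∣+∣∣+∣∣ : (L U : Subset n) → Empty (L ∩ U) → ∣ ∁ (L ∪ U) ∣ + ∣ L ∣ + ∣ U ∣ ≡ n
∣∁∪∣+∣∣+∣∣ []            []            _ = refl
∣∁∪∣+∣∣+∣∣ (inside ∷ L)  (inside ∷ U)  d = contradiction (zero , here) d
∣∁∪∣+∣∣+∣∣ (inside ∷ L)  (outside ∷ U) d =
  trans (cong (_+ ∣ U ∣) (ℕ.+-suc ∣ ∁ (L ∪ U) ∣ ∣ L ∣)) (cong suc (∣∁∪∣+∣∣+∣∣ L U (drop-∷-Empty d)))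
∣∁∪∣+∣∣+∣∣ (outside ∷ L) (inside ∷ U)  d =
  trans (ℕ.+-suc _ ∣ U ∣) (cong suc (∣∁∪∣+∣∣+∣∣ L U (drop-∷-Empty d)))
∣∁∪∣+∣∣+∣∣ (outside ∷ L) (outside ∷ U) d = cong suc (∣∁∪∣+∣∣+∣∣ L U (drop-∷-Empty d))

-- Division in the rationals

-- `_/_` reduces fractions, so the comparison is made among unnormalised rationals, where products
-- are formed componentwise.
/-*-/ : ∀ a b c d .{{_ : NonZero b}} .{{_ : NonZero d}} .{{_ : NonZero (b ℕ.* d)}} →
        (a / b) * (c / d) ≡ (a ℤ.* c) / (b ℕ.* d)
/-*-/ a (suc b) c (suc d) = ℚ.toℚᵘ-injective (ℚᵘ.≃-trans
  (ℚ.toℚᵘ-homo-* (a / suc b) (c / suc d))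
  (ℚᵘ.≃-trans (ℚᵘ.*-cong (ℚ.toℚᵘ-fromℚᵘ (ℚᵘ.mkℚᵘ a b)) (ℚ.toℚᵘ-fromℚᵘ (ℚᵘ.mkℚᵘ c d)))
              (ℚᵘ.≃-sym (ℚ.toℚᵘ-fromℚᵘ (ℚᵘ.mkℚᵘ a b ℚᵘ.* ℚᵘ.mkℚᵘ c d)))))

fromℕ-* : ∀ a b → fromℕ (a ℕ.* b) ≡ fromℕ a * fromℕ b
fromℕ-* a b = trans (cong (_/ 1) (ℤ.pos-* a b)) (sym (/-*-/ (+ a) 1 (+ b) 1))

fromℕ-*-1/ : ∀ c d .{{_ : NonZero d}} → fromℕ (c ℕ.* d) * (+ 1 / d) ≡ fromℕ c
fromℕ-*-1/ c d@(suc _) = trans (/-*-/ (+ (c ℕ.* d)) 1 (+ 1) d)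
  (ℚ.fromℚᵘ-cong {ℚᵘ.mkℚᵘ (+ (c ℕ.* d) ℤ.* + 1) _} {ℚᵘ.mkℚᵘ (+ c) 0} (ℚᵘ.*≡* (begin
    + (c ℕ.* d) ℤ.* + 1 ℤ.* + 1  ≡⟨ cong (λ x → x ℤ.* + 1 ℤ.* + 1) (ℤ.pos-* c d) ⟩
    + c ℤ.* + d ℤ.* + 1 ℤ.* + 1  ≡⟨ lemma (+ c) (+ d) ⟩
    + c ℤ.* (+ 1 ℤ.* + d)        ≡⟨ cong (+ c ℤ.*_) (ℤ.pos-* 1 d) ⟨
    + c ℤ.* + (1 ℕ.* d)          ∎)))
  where
  lemma : ∀ x y → x ℤ.* y ℤ.* + 1 ℤ.* + 1 ≡ x ℤ.* (+ 1 ℤ.* y)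
  lemma = ℤSolver.solve-∀

-- The exponent `f - 1` is negative only for `f = 0`, where `p` is `c` times `b` and the power is
-- `1 / b`; otherwise one factor `b` cancels in the natural numbers.
divide-^ : ∀ b .{{_ : NonZero b}} c p f → b ℕ.* c ≡ p ℕ.* b ^ f →
           fromℕ c ≡ fromℕ p * (b ^ℤ (+ f - + 1))
divide-^ b c p zero eq = begin
  fromℕ c                                ≡⟨ fromℕ-*-1/ c (b ^ 1) ⟨
  fromℕ (c ℕ.* b ^ 1) * (+ 1 / (b ^ 1))  ≡⟨ cong (λ x → fromℕ x * (+ 1 / (b ^ 1))) eq′ ⟩
  fromℕ p * (+ 1 / (b ^ 1))              ∎
  where
  instance
    nz : NonZero (b ^ 1)
    nz = ℕ.m^n≢0 b 1
  eq′ : c ℕ.* b ^ 1 ≡ p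
  eq′ = begin
    c ℕ.* (b ℕ.* 1)  ≡⟨ cong (c ℕ.*_) (ℕ.*-identityʳ b) ⟩
    c ℕ.* b          ≡⟨ ℕ.*-comm c b ⟩
    b ℕ.* c          ≡⟨ eq ⟩
    p ℕ.* 1          ≡⟨ ℕ.*-identityʳ p ⟩
    p                ∎
divide-^ b c p (suc f) eq = trans (cong fromℕ c≡) (fromℕ-* p (b ^ f))
  where
  c≡ : c ≡ p ℕ.* b ^ f
  c≡ = ℕ.*-cancelˡ-≡ c (p ℕ.* b ^ f) b (trans eq (lemma p b (b ^ f)))
    where
    lemma : ∀ p b x → p ℕ.* (b ℕ.* x) ≡ b ℕ.* (p ℕ.* x)
    lemma = solve-∀

-- The number of restricted parking functions

theorem2p1 : (n : ℕ) → n ≥ 1 → (L U : Subset n) → Empty (L ∩ U) →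
    fromℕ (count (restricted? L U)) ≡
    fromℕ (∏[ i ∈ L ] (n + 2 ∸ label i)) * fromℕ (∏[ i ∈ U ] (label i ∸ 1)) * (suc n ^ℤ (+ n - + ∣ L ∣ - + ∣ U ∣ - + 1))
theorem2p1 n _ L U disjoint = begin
  fromℕ (count (restricted? L U))
    ≡⟨ divide-^ (suc n) (count (restricted? L U)) (P ℕ.* Q) f counted ⟩
  fromℕ (P ℕ.* Q) * (suc n ^ℤ (+ f - + 1))
    ≡⟨ cong₂ (λ q e → q * (suc n ^ℤ e)) (fromℕ-* P Q) exponent ⟩
  fromℕ P * fromℕ Q * (suc n ^ℤ (+ n - + ∣ L ∣ - + ∣ U ∣ - + 1)) ∎
  where
  P = ∏[ i ∈ L ] (n + 2 ∸ label i)
  Q = ∏[ i ∈ U ] (label i ∸ 1)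
  f = ∣ ∁ (L ∪ U) ∣
  counted : suc n ℕ.* count (restricted? L U) ≡ P ℕ.* Q ℕ.* suc n ^ f
  counted = begin
    suc n ℕ.* count (restricted? L U)
      ≡⟨ count-restricted L U ⟩
    total (suc n) L U 0
      ≡⟨ total-closed (suc n) L U 0 disjoint (ℕ.n≤1+n n) ⟩
    ∏[ i ∈ L ] (suc n ∸ toℕ i) ℕ.* Q ℕ.* suc n ^ f
      -- Labels start at 1 and indices at 0: `suc n ∸ toℕ i` equals `2 + n ∸ label i`, and
      -- `label i ∸ 1` is `toℕ i`.
      ≡⟨ cong (λ x → x ℕ.* Q ℕ.* suc n ^ f)
           (∏-cong L (λ i → cong (_∸ label i) (sym (ℕ.+-comm n 2)))) ⟩
    P ℕ.* Q ℕ.* suc n ^ f ∎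
  exponent : + f - + 1 ≡ + n - + ∣ L ∣ - + ∣ U ∣ - + 1
  exponent = begin
    + f - + 1
      ≡⟨ lemma (+ f) (+ ∣ L ∣) (+ ∣ U ∣) ⟩
    + f ℤ.+ + ∣ L ∣ ℤ.+ + ∣ U ∣ - + ∣ L ∣ - + ∣ U ∣ - + 1
      -- `L`, `U` and the `f` unrestricted cars partition the `n` cars.
      ≡⟨ cong (λ x → + x - + ∣ L ∣ - + ∣ U ∣ - + 1) (∣∁∪∣+∣∣+∣∣ L U disjoint) ⟩
    + n - + ∣ L ∣ - + ∣ U ∣ - + 1 ∎
    where
    lemma : ∀ x y z → x - + 1 ≡ x ℤ.+ y ℤ.+ z - y - z - + 1
    lemma = ℤSolver.solve-∀
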